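{- Every $3$-coloring of the edges of $K_{\mathbb{N}}$ contains a monochromatic connected subgraph $T$ with $\bar{d}_s(T)\geq 1/2$.
   Context: $K_{\mathbb{N}}$ is the complete graph on the positive integers $\mathbb{N}$; a $3$-coloring is a partition of its edges into three color classes, and a monochromatic subgraph is one all of whose edges have the same color. For an infinite sequence $A=(a_1,a_2,\dots)$ of distinct positive integers, let $f(n)=\sup\{m:\{a_1,\dots,a_m\}\subseteq\{1,\dots,n\}\}$ and $\bar{d}_s(A)=\limsup_{n\to\infty}f(n)/n$. For a connected subgraph $T$ of $K_{\mathbb{N}}$, its strong upper density is $\bar{d}_s(T)=\sup_{V\in\pi}\bar{d}_s(V)$, where $\pi$ is the set of all orderings $(v_1,v_2,\dots)$ of $V(T)$ such that for every $k\geq 1$ the subgraph of $T$ induced by $\{v_1,\dots,v_k\}$ is connected. -}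

module Defs where

open import Data.Nat as ℕ using (ℕ; zero; suc; _≤_; _<_)
open import Data.Fin using (Fin)
open import Data.Product using (Σ; ∃; ∃-syntax; _×_; _,_)
open import Data.Integer using (+_)
open import Data.Rational as ℚ using (ℚ; _/_; _-_; 0ℚ)
open import Relation.Binary.PropositionalEquality using (_≡_)
open import Relation.Nullary using (¬_)
open import Function.Definitions using (Injective)

-- CONVENTION: the vertex set of K_ℕ is the positive integers; we encode the
-- positive integer i+1 by the natural number i : ℕ. Thus {1,…,n} corresponds
-- to {i : ℕ ∣ i < n}.

-- A 3-coloring of the edges of K_ℕ: a colour for every unordered pair of
-- distinct vertices, given as a symmetric function (diagonal values unused).
Coloring : Set
Coloring = ℕ → ℕ → Fin 3

IsSymmetric : Coloring → Set
IsSymmetric c = ∀ x y → c x y ≡ c y x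

record Subgraph : Set₁ where
  field
    V     : ℕ → Set
    E     : ℕ → ℕ → Set
    E-sym : ∀ {x y} → E x y → E y x
    E-V   : ∀ {x y} → E x y → V x × V y
    E-irr : ∀ {x} → ¬ E x x
open Subgraph public

data Path (R : ℕ → ℕ → Set) : ℕ → ℕ → Set where
  here : ∀ {x} → Path R x x
  step : ∀ {x y z} → R x y → Path R y z → Path R x z

Connected : Subgraph → Set
Connected T = ∀ x y → V T x → V T y → Path (E T) x y

Monochromatic : Coloring → Fin 3 → Subgraph → Set
Monochromatic c col T = ∀ {x y} → E T x y → c x y ≡ col

InPrefix : (ℕ → ℕ) → ℕ → ℕ → Set
InPrefix a k x = ∃[ i ] (i < k × a i ≡ x)

PrefixConnected : Subgraph → (ℕ → ℕ) → ℕ → Set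
PrefixConnected T a k =
  ∀ i j → i < k → j < k →
    Path (λ x y → E T x y × InPrefix a k x × InPrefix a k y) (a i) (a j)

IsConnectedOrdering : Subgraph → (ℕ → ℕ) → Set
IsConnectedOrdering T a =
  Injective _≡_ _≡_ a
  × (∀ k → V T (a k))
  × (∀ v → V T v → ∃[ k ] a k ≡ v)
  × (∀ k → 1 ≤ k → PrefixConnected T a k)

-- f(n) = m : m = sup{m : {a_1,…,a_m} ⊆ {1,…,n}} (in our shifted encoding:
-- a_0,…,a_{m-1} are all < n, and a_m is not).
CountBelow : (ℕ → ℕ) → ℕ → ℕ → Set
CountBelow a n m = (∀ i → i < m → a i ℕ.< n) × n ≤ a m

InfOftenAbove : (ℕ → ℕ) → ℚ → Set
InfOftenAbove a q =
  ∀ N → ∃[ n ] (N ≤ n × ∃[ m ] (CountBelow a (suc n) m × q ℚ.< (+ m) / suc n))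

-- d̄_s(T) ≥ r, i.e. sup_{A ∈ π} limsup f_A(n)/n ≥ r, unfolded as:
-- for every ε > 0 there is a connected ordering A of V(T) with
-- f_A(n)/n > r - ε for infinitely many n.
StrongUpperDensityAtLeast : Subgraph → ℚ → Set
StrongUpperDensityAtLeast T r =
  ∀ (ε : ℚ) → 0ℚ ℚ.< ε →
    ∃[ a ] (IsConnectedOrdering T a × InfOftenAbove a (r - ε))

-- Write C i n v for the component of v in colour i inside {0,…,n-1}.
-- Some C i n v has at least n/2 elements for infinitely many n. Otherwise
-- all three C i n 0 are eventually smaller than n/2. No two of them then cover
-- {0,…,n-1}, which forces every vertex either to lie in all three (the core)
-- or in exactly one (being private to that colour i), and makes all edges between
-- private vertices of two colours have the third colour. A vertex w private
-- to colour 0 stays private when n grows by one, since otherwise all older vertices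
-- would enter the core; but C 2 n 0 and C 2 n w always cover {0,…,n-1}.
-- For T take that infinite component, ordered as in Prim's algorithm: always append
-- the least vertex joined to the previous ones. Such an ordering exhausts
-- C i n v before leaving {0,…,n-1}, for every n > v.
module Submission where

open import Defs
open import Level using (0ℓ)
open import Axiom.ExcludedMiddle using (ExcludedMiddle)
open import Axiom.DoubleNegationElimination using (em⇒dne)
open import Data.Fin using (Fin; zero; suc; fromℕ<)
import Data.Fin.Properties as Fin
open import Data.Integer as ℤ using (+_; +≤+)
import Data.Integer.Properties as ℤ
open import Data.List using (List; []; _∷_; _++_; length; lookup)
open import Data.List.Properties using (length-++)
open import Data.List.Membership.Propositional using (_∈_; _∉_)
open import Data.List.Membership.Propositional.Properties using (∈-++⁺ˡ; ∈-++⁺ʳ)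
open import Data.List.Relation.Unary.Any using (here; there; index)
open import Data.List.Relation.Unary.Any.Properties using (lookup-index)
open import Data.Nat using (ℕ; zero; suc; _+_; _*_; _≤_; _<_; _⊔_; s≤s; z<s)
open import Data.Nat.Induction using (<-rec)
open import Data.Nat.Properties
open import Data.Product using (Σ; ∃; ∃-syntax; ∃₂; _×_; _,_; proj₁; proj₂)
open import Data.Rational using (½; 0ℚ; _/_; _-_) renaming (_<_ to _<ℚ_; _≤_ to _≤ℚ_)
import Data.Rational.Properties as ℚ
import Data.Rational.Unnormalised as ℚᵘ
import Data.Rational.Unnormalised.Properties as ℚᵘ
open import Data.Sum using (_⊎_; inj₁; inj₂)
open import Data.Unit using (tt)
open import Function using (_∘_)
open import Function.Definitions using (Injective)
open import Relation.Binary.Definitions using (tri<; tri≈; tri>)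
open import Relation.Binary.PropositionalEquality
open import Relation.Nullary using (¬_; yes; no; contradiction)
open import Relation.Nullary.Decidable using (toWitness; _⊎-dec_)

-- Three colours, paths, and counting by lists.

third-colour-unique : ∀ (i j k l : Fin 3) →
  i ≡ j ⊎ k ≡ i ⊎ k ≡ j ⊎ l ≡ i ⊎ l ≡ j ⊎ l ≡ k
third-colour-unique = toWitness {a? =
  Fin.all? λ i → Fin.all? λ j → Fin.all? λ k → Fin.all? λ l →
    (i Fin.≟ j) ⊎-dec (k Fin.≟ i) ⊎-dec (k Fin.≟ j) ⊎-dec
    (l Fin.≟ i) ⊎-dec (l Fin.≟ j) ⊎-dec (l Fin.≟ k)} tt

third-colour : ∀ {i j k l : Fin 3} → i ≢ j → k ≢ i → k ≢ j → l ≢ i → l ≢ j → l ≡ k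
third-colour {i} {j} {k} {l} i≢j k≢i k≢j l≢i l≢j with third-colour-unique i j k l
... | inj₁ p = contradiction p i≢j
... | inj₂ (inj₁ p) = contradiction p k≢i
... | inj₂ (inj₂ (inj₁ p)) = contradiction p k≢j
... | inj₂ (inj₂ (inj₂ (inj₁ p))) = contradiction p l≢i
... | inj₂ (inj₂ (inj₂ (inj₂ (inj₁ p)))) = contradiction p l≢j
... | inj₂ (inj₂ (inj₂ (inj₂ (inj₂ p)))) = p

other-colours : ∀ (j : Fin 3) → ∃₂ λ i k → i ≢ j × k ≢ j × i ≢ k
other-colours zero             = suc zero , suc (suc zero) , (λ ()) , (λ ()) , (λ ())
other-colours (suc zero)       = zero , suc (suc zero) , (λ ()) , (λ ()) , (λ ())
other-colours (suc (suc zero)) = zero , suc zero , (λ ()) , (λ ()) , (λ ())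

_++ᵖ_ : ∀ {R x y z} → Path R x y → Path R y z → Path R x z
here     ++ᵖ q = q
step r p ++ᵖ q = step r (p ++ᵖ q)

reverseᵖ : ∀ {R x y} → (∀ {a b} → R a b → R b a) → Path R x y → Path R y x
reverseᵖ sy here       = here
reverseᵖ sy (step r p) = reverseᵖ sy p ++ᵖ step (sy r) here

mapᵖ : ∀ {R S x y} → (∀ {a b} → R a b → S a b) → Path R x y → Path S x y
mapᵖ f here       = here
mapᵖ f (step r p) = step (f r) (mapᵖ f p)

-- Sending a number to a position where it occurs in `L` is injective, since `lookup` recovers it.
initial-segment-length : ∀ {n} (L : List ℕ) → (∀ {x} → x < n → x ∈ L) → n ≤ length L
initial-segment-length {n} L h = Fin.injective⇒≤ {f = f} f-inj
  where
  f : Fin n → Fin (length L)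
  f i = index (h (Fin.toℕ<n i))
  f-inj : Injective _≡_ _≡_ f
  f-inj {i} {j} e = Fin.toℕ-injective
    (trans (lookup-index (h (Fin.toℕ<n i)))
      (trans (cong (lookup L) e) (sym (lookup-index (h (Fin.toℕ<n j))))))

-- Fewer than n/2 elements below n, witnessed by a covering list so that nothing need be counted.
Small : (ℕ → Set) → ℕ → Set
Small P n = ∃[ L ] ((∀ {x} → x < n → P x → x ∈ L) × 2 * length L < n)

small-pair : ∀ {P Q n} → Small P n → Small Q n → ¬ (∀ {x} → x < n → P x ⊎ Q x)
small-pair {P} {Q} {n} (L , cL , l) (M , cM , m) cov = <-irrefl refl (begin-strict
  2 * n                       ≤⟨ *-monoʳ-≤ 2 (initial-segment-length (L ++ M) all) ⟩
  2 * length (L ++ M)         ≡⟨ cong (2 *_) (length-++ L) ⟩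
  2 * (length L + length M)   ≡⟨ *-distribˡ-+ 2 (length L) (length M) ⟩
  2 * length L + 2 * length M <⟨ +-mono-< l m ⟩
  n + n                       ≡⟨ cong (_+_ n) (sym (+-identityʳ n)) ⟩
  2 * n                       ∎)
  where
  open ≤-Reasoning
  all : ∀ {x} → x < n → x ∈ L ++ M
  all x<n with cov x<n
  ... | inj₁ p = ∈-++⁺ˡ (cL x<n p)
  ... | inj₂ q = ∈-++⁺ʳ L (cM x<n q)

half≤ : ∀ m {n} → suc n ≤ 2 * m → ½ ≤ℚ (+ m) / suc n
half≤ m {n} h = ℚ.toℚᵘ-cancel-≤
  (ℚᵘ.≤-respʳ-≃ (ℚᵘ.≃-sym (ℚ.toℚᵘ-fromℚᵘ (ℚᵘ.mkℚᵘ (+ m) n))) (ℚᵘ.*≤* (subst₂ ℤ._≤_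
    (ℤ.pos-* 1 (suc n)) (ℤ.pos-* m 2)
    (+≤+ (subst₂ _≤_ (sym (*-identityˡ (suc n))) (*-comm 2 m) h)))))

½-ε<½ : ∀ {ε} → 0ℚ <ℚ ε → ½ - ε <ℚ ½
½-ε<½ {ε} 0<ε = subst (½ - ε <ℚ_) (ℚ.+-identityʳ ½) (ℚ.+-monoʳ-< ½ (ℚ.neg-antimono-< 0<ε))

module _ (em : ExcludedMiddle 0ℓ) where

  private
    dne : {P : Set} → ¬ ¬ P → P
    dne = em⇒dne em

  least : (P : ℕ → Set) → ∃ P → ∃[ m ] (P m × (∀ {y} → y < m → ¬ P y))
  least P (x , px) = <-rec (λ x → P x → ∃[ m ] (P m × (∀ {y} → y < m → ¬ P y))) go x px
    where
    go : ∀ x → (∀ {y} → y < x → P y → ∃[ m ] (P m × (∀ {y} → y < m → ¬ P y))) →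
         P x → ∃[ m ] (P m × (∀ {y} → y < m → ¬ P y))
    go x rec px with em {∃[ y ] (y < x × P y)}
    ... | yes (y , y<x , py) = rec y<x py
    ... | no none            = x , px , λ y<x py → none (_ , y<x , py)

  -- Colour components of the vertex 0 in an initial segment.

  module _ (c : Coloring) (c-sym : IsSymmetric c) where

    Within : Fin 3 → ℕ → ℕ → ℕ → Set
    Within i n x y = c x y ≡ i × x < n × y < n

    Comp : Fin 3 → ℕ → ℕ → ℕ → Set
    Comp i n v x = Path (Within i n) v x

    extend : ∀ {i n v x y} → Comp i n v x → x < n → y < n → c x y ≡ i → Comp i n v y
    extend p x<n y<n e = p ++ᵖ step (e , x<n , y<n) here

    Comp-mono : ∀ {i n m v x} → n ≤ m → Comp i n v x → Comp i m v x
    Comp-mono n≤m = mapᵖ λ (e , a , b) → e , <-≤-trans a n≤m , <-≤-trans b n≤m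

    Core : ℕ → ℕ → Set
    Core n x = ∀ k → Comp k n 0 x

    Private : ℕ → Fin 3 → ℕ → Set
    Private n i x = Comp i n 0 x × (∀ {j} → j ≢ i → ¬ Comp j n 0 x)

    -- Colour `i` would carry `y` into the component of 0 in colour `i`, and colour `j` would carry
    -- `x` into that in colour `j`.
    private-edge : ∀ {n i j k x y} → i ≢ j → k ≢ i → k ≢ j → x < n → y < n →
                   Private n i x → Private n j y → c x y ≡ k
    private-edge i≢j k≢i k≢j x<n y<n (x∈i , x∉) (y∈j , y∉) =
      third-colour i≢j k≢i k≢j
        (λ e → y∉ i≢j (extend x∈i x<n y<n e))
        (λ e → x∉ (i≢j ∘ sym) (extend y∈j y<n x<n (trans (c-sym _ _) e)))

    Balanced : ℕ → Set
    Balanced n = ∀ i → Small (Comp i n 0) n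

    module _ {n} (0<n : 0 < n) (balanced : Balanced n) where

      uncovered : ∀ i j → ∃[ x ] (x < n × ¬ Comp i n 0 x × ¬ Comp j n 0 x)
      uncovered i j = dne λ none → small-pair (balanced i) (balanced j) λ {x} x<n →
        dne λ neither → none (x , x<n , neither ∘ inj₁ , neither ∘ inj₂)

      -- For `x` outside both components, the edges from 0 and from `z` to `x` avoid `i` and `j`, so
      -- 0, `x`, `z` is a path in the remaining colour.
      two⇒core : ∀ {i j z} → i ≢ j → z < n → Comp i n 0 z → Comp j n 0 z → Core n z
      two⇒core {i} {j} {z} i≢j z<n z∈i z∈j k with k Fin.≟ i | k Fin.≟ j
      ... | yes refl | _        = z∈i
      ... | no _     | yes refl = z∈j
      ... | no k≢i   | no k≢j   =
        let x , x<n , x∉i , x∉j = uncovered i j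
            0x≡k = third-colour i≢j k≢i k≢j
                     (λ e → x∉i (extend here 0<n x<n e))
                     (λ e → x∉j (extend here 0<n x<n e))
            zx≡k = third-colour i≢j k≢i k≢j
                     (λ e → x∉i (extend z∈i z<n x<n e))
                     (λ e → x∉j (extend z∈j z<n x<n e))
        in extend (extend here 0<n x<n 0x≡k) x<n z<n (trans (c-sym _ _) zx≡k)

      core-or-private : ∀ {z} → z < n → Core n z ⊎ (∃[ l ] Private n l z)
      core-or-private {z} z<n with em {∃[ j ] (j ≢ c 0 z × Comp j n 0 z)}
      ... | yes (j , j≢ , z∈j) = inj₁ (two⇒core j≢ z<n z∈j (extend here 0<n z<n refl))
      ... | no none = inj₂ (c 0 z , extend here 0<n z<n refl , λ j≢ z∈j → none (_ , j≢ , z∈j))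

      -- A vertex missed by both other colours is outside the core, and `j` is the only colour left
      -- for it.
      private-exists : ∀ j → ∃[ x ] (x < n × Private n j x)
      private-exists j with other-colours j
      ... | i , k , i≢j , k≢j , i≢k with uncovered i k
      ... | x , x<n , x∉i , x∉k with core-or-private x<n
      ... | inj₁ core = contradiction (core i) x∉i
      ... | inj₂ (l , x∈l , x∉) = x , x<n , subst (λ l → Private n l x) l≡j (x∈l , x∉)
        where
        l≡j = third-colour i≢k (i≢j ∘ sym) (k≢j ∘ sym)
                (λ { refl → x∉i x∈l }) (λ { refl → x∉k x∈l })

    -- Old paths survive, so losing privacy means entering a second component of 0, hence the core,
    -- which `collapse` rules out.
    private-persists : ∀ {n i w} → 0 < n → Balanced n → Balanced (suc n) → w < n →
                       Private n i w → Private (suc n) i w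
    private-persists {n} {i} {w} 0<n bal bal⁺ w<n w∈@(w∈i , _) =
      grow w∈i , λ j≢i w∈j → collapse (two⇒core z<s bal⁺ j≢i (m<n⇒m<1+n w<n) w∈j (grow w∈i))
      where
      grow : ∀ {k x} → Comp k n 0 x → Comp k (suc n) 0 x
      grow = Comp-mono (n≤1+n n)

      -- The old privacy of `x` keeps the edge `xy` from having colour `l`; once `x` is in the core,
      -- this edge takes `y` into a second component of 0.
      spread : ∀ {k l x y} → k ≢ l → x < n → y < n → Private n k x → Private n l y →
               Core (suc n) x → Core (suc n) y
      spread {k} {l} {x} {y} k≢l x<n y<n x∈ y∈ core =
        two⇒core z<s bal⁺ xy≢l y<1+n
          (extend (core (c x y)) (m<n⇒m<1+n x<n) y<1+n refl) (grow (proj₁ y∈))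
        where
        y<1+n = m<n⇒m<1+n y<n
        xy≢l : c x y ≢ l
        xy≢l e = proj₂ x∈ (k≢l ∘ sym)
          (extend (proj₁ y∈) y<n x<n (trans (c-sym y x) e))

      -- All older vertices would enter the core, and the edge from 0 to `n` adds the new one, so
      -- the component of 0 in colour `c 0 n` would cover everything.
      collapse : ¬ Core (suc n) w
      collapse core with uncovered z<s bal⁺ (c 0 n) (c 0 n)
      ... | x , x<1+n , x∉ , _ with m<1+n⇒m<n∨m≡n x<1+n
      ... | inj₂ refl = x∉ (extend here z<s x<1+n refl)
      ... | inj₁ x<n with core-or-private 0<n bal x<n
      ... | inj₁ old = x∉ (grow (old _))
      ... | inj₂ (l , x∈) with i Fin.≟ l
      ... | no i≢l = x∉ (spread i≢l w<n x<n w∈ x∈ core _)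
      -- `spread` needs two different colours, so `x`, private to `i` like `w`, is reached through
      -- some `z` private to `j`.
      ... | yes refl with other-colours i
      ... | j , _ , j≢i , _ with private-exists 0<n bal j
      ... | z , z<n , z∈ =
        x∉ (spread j≢i z<n x<n z∈ x∈ (spread (j≢i ∘ sym) w<n z<n w∈ z∈ core) _)

    -- Edges from `w` to vertices private to `j` have colour `g`; vertices private to `i` are
    -- reached by two such edges, through a vertex private to `j`. All others lie in the component
    -- of 0.
    two-components-cover : ∀ {n i j g w} → 0 < n → Balanced n → i ≢ j → g ≢ i → g ≢ j → w < n →
                         Private n i w → ∀ {x} → x < n → Comp g n 0 x ⊎ Comp g n w x
    two-components-cover {n} {i} {j} {g} 0<n bal i≢j g≢i g≢j w<n w∈ x<n
      with core-or-private 0<n bal x<n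
    ... | inj₁ core = inj₁ (core g)
    ... | inj₂ (l , x∈) with l Fin.≟ g | l Fin.≟ i
    ... | yes refl | _ = inj₁ (proj₁ x∈)
    ... | no l≢g | no l≢i = inj₂ (extend here w<n x<n
      (private-edge (l≢i ∘ sym) g≢i (l≢g ∘ sym) w<n x<n w∈ x∈))
    ... | no _ | yes refl =
      let y , y<n , y∈ = private-exists 0<n bal j
      in inj₂ (extend (extend here w<n y<n (private-edge i≢j g≢i g≢j w<n y<n w∈ y∈)) y<n x<n
                 (private-edge (i≢j ∘ sym) g≢j g≢i y<n x<n y∈ x∈))

    -- A component that is large infinitely often.

    OftenLarge : Fin 3 → ℕ → Set
    OftenLarge i v = ∀ N → ∃[ n ] (N ≤ n × ¬ Small (Comp i n v) n)

    eventually-small : ∀ {i v} → ¬ OftenLarge i v → ∃[ N ] (∀ n → N ≤ n → Small (Comp i n v) n)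
    eventually-small ¬large = dne λ none → ¬large λ N → dne λ no-n →
      none (N , λ n N≤n → dne λ ¬small → no-n (_ , N≤n , ¬small))

    often-large : ∃₂ OftenLarge
    often-large = dne λ none →
      let small : ∀ i v → ∃[ N ] (∀ n → N ≤ n → Small (Comp i n v) n)
          small i v = eventually-small λ large → none (i , v , large)
          N₀ , s₀ = small zero 0
          N₁ , s₁ = small (suc zero) 0
          N₂ , s₂ = small (suc (suc zero)) 0
          M = suc (N₀ ⊔ (N₁ ⊔ N₂))
          N₀≤ : ∀ {n} → M ≤ n → N₀ ≤ n
          N₀≤ M≤n = ≤-trans (m≤m⊔n N₀ _) (<⇒≤ M≤n)
          N₁≤ : ∀ {n} → M ≤ n → N₁ ≤ n
          N₁≤ M≤n = ≤-trans (≤-trans (m≤m⊔n N₁ N₂) (m≤n⊔m N₀ _)) (<⇒≤ M≤n)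
          N₂≤ : ∀ {n} → M ≤ n → N₂ ≤ n
          N₂≤ M≤n = ≤-trans (≤-trans (m≤n⊔m N₁ N₂) (m≤n⊔m N₀ _)) (<⇒≤ M≤n)
          bal : ∀ {n} → M ≤ n → Balanced n
          bal M≤n = λ { zero             → s₀ _ (N₀≤ M≤n)
                        ; (suc zero)       → s₁ _ (N₁≤ M≤n)
                        ; (suc (suc zero)) → s₂ _ (N₂≤ M≤n) }
          w , w<M , w∈ = private-exists z<s (bal ≤-refl) zero
          -- The threshold `N` is known only once `w` is chosen, so `w` must stay private up to
          -- `N + M`, where both components are small yet cover everything.
          N , s = small (suc (suc zero)) w
          M≤ = m≤n+m M N
          0<n = <-≤-trans z<s M≤
      in small-pair (bal M≤ (suc (suc zero))) (s _ (m≤m+n N M))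
           (two-components-cover {j = suc zero} 0<n (bal M≤) (λ ()) (λ ()) (λ ())
             (<-≤-trans w<M M≤) (persists M z<s bal w<M w∈ N))
      where
      persists : ∀ M → 0 < M → (∀ {n} → M ≤ n → Balanced n) → ∀ {i w} → w < M →
                 Private M i w → ∀ d → Private (d + M) i w
      persists M 0<M bal w<M w∈ zero = w∈
      persists M 0<M bal w<M w∈ (suc d) =
        private-persists (<-≤-trans 0<M (m≤n+m M d)) (bal (m≤n+m M d)) (bal (m≤n+m M (suc d)))
          (<-≤-trans w<M (m≤n+m M d)) (persists M 0<M bal w<M w∈ d)

    -- The Prim ordering and its density.

    module Prim (col : Fin 3) (v : ℕ) (large : OftenLarge col v) where

      -- The disjunct `y ≡ v` makes the ordering start at `v`, the only frontier vertex of the empty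
      -- list.
      Frontier : List ℕ → ℕ → Set
      Frontier L y = y ∉ L × (y ≡ v ⊎ ∃[ x ] (x ∈ L × c x y ≡ col))

      -- A path leaving `L` would do so at a frontier vertex below `n`, and a missing `v` would be
      -- one itself.
      exhausts : ∀ {L n} → v < n → (∀ {y} → y < n → ¬ Frontier L y) →
                 ∀ {x} → Comp col n v x → x ∈ L
      exhausts {L} {n} v<n stuck = walk (dne λ v∉L → stuck v<n (v∉L , inj₁ refl))
        where
        walk : ∀ {x y} → x ∈ L → Comp col n x y → y ∈ L
        walk x∈L here = x∈L
        walk x∈L (step (e , _ , z<n) p) =
          walk (dne λ z∉L → stuck z<n (z∉L , inj₂ (_ , x∈L , e))) p

      frontier-nonempty : ∀ L → ∃ (Frontier L)
      frontier-nonempty L = dne λ none →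
        -- This `n` exceeds both `v` and twice the length of `L`, so a stuck `L` would itself
        -- witness smallness.
        let n , N≤n , ¬small = large (suc v ⊔ suc (2 * length L))
            v<n = ≤-trans (m≤m⊔n (suc v) (suc (2 * length L))) N≤n
        in ¬small (L , (λ _ → exhausts v<n (λ _ f → none (_ , f))) ,
                   ≤-trans (m≤n⊔m (suc v) (suc (2 * length L))) N≤n)

      next : List ℕ → ℕ
      next L = proj₁ (least (Frontier L) (frontier-nonempty L))

      visited : ℕ → List ℕ
      visited zero    = []
      visited (suc k) = next (visited k) ∷ visited k

      a : ℕ → ℕ
      a k = next (visited k)

      a-frontier : ∀ k → Frontier (visited k) (a k)
      a-frontier k = proj₁ (proj₂ (least (Frontier (visited k)) (frontier-nonempty (visited k))))

      a-least : ∀ k {y} → y < a k → ¬ Frontier (visited k) y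
      a-least k = proj₂ (proj₂ (least (Frontier (visited k)) (frontier-nonempty (visited k))))

      length-visited : ∀ k → length (visited k) ≡ k
      length-visited zero    = refl
      length-visited (suc k) = cong suc (length-visited k)

      ∈visited : ∀ {i k} → i < k → a i ∈ visited k
      ∈visited {i} {suc k} i<1+k with m<1+n⇒m<n∨m≡n i<1+k
      ... | inj₁ i<k  = there (∈visited i<k)
      ... | inj₂ refl = here refl

      visited-index : ∀ {k x} → x ∈ visited k → InPrefix a k x
      visited-index {suc k} (here refl) = k , ≤-refl , refl
      visited-index {suc k} (there x∈)  =
        let i , i<k , e = visited-index x∈ in i , m<n⇒m<1+n i<k , e

      a-distinct : ∀ {i j} → i < j → a i ≢ a j
      a-distinct {i} {j} i<j e = proj₁ (a-frontier j) (subst (_∈ visited j) e (∈visited i<j))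

      a-injective : Injective _≡_ _≡_ a
      a-injective {i} {j} e with <-cmp i j
      ... | tri< i<j _ _ = contradiction e (a-distinct i<j)
      ... | tri≈ _ i≡j _ = i≡j
      ... | tri> _ _ j<i = contradiction (sym e) (a-distinct j<i)

      -- With the range of `a` as vertex set, `a` enumerates it by definition. The condition `x ≢ y`
      -- discards the diagonal values of `c`.
      T : Subgraph
      T = record
        { V     = λ x → ∃[ k ] a k ≡ x
        ; E     = λ x y → x ≢ y × c x y ≡ col × (∃[ k ] a k ≡ x) × (∃[ k ] a k ≡ y)
        ; E-sym = λ (x≢y , e , x∈ , y∈) → x≢y ∘ sym , trans (c-sym _ _) e , y∈ , x∈
        ; E-V   = λ (_ , _ , x∈ , y∈) → x∈ , y∈
        ; E-irr = λ (x≢x , _) → x≢x refl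
        }

      EdgeIn : ℕ → ℕ → ℕ → Set
      EdgeIn k x y = E T x y × InPrefix a k x × InPrefix a k y

      EdgeIn-sym : ∀ {k x y} → EdgeIn k x y → EdgeIn k y x
      EdgeIn-sym (e , x∈ , y∈) = E-sym T e , y∈ , x∈

      -- Each vertex other than `v` was appended because of an edge to an earlier one, so descending
      -- never leaves the prefix.
      path-to-root : ∀ {k} j → j < k → Path (EdgeIn k) (a j) v
      path-to-root {k} = <-rec (λ j → j < k → Path (EdgeIn k) (a j) v) go
        where
        go : ∀ j → (∀ {i} → i < j → i < k → Path (EdgeIn k) (a i) v) →
             j < k → Path (EdgeIn k) (a j) v
        go j rec j<k with proj₂ (a-frontier j)
        ... | inj₁ e = subst (Path (EdgeIn k) (a j)) e here
        ... | inj₂ (x , x∈ , e) with visited-index x∈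
        ... | i , i<j , refl =
          step ((a-distinct i<j ∘ sym , trans (c-sym _ _) e , (j , refl) , (i , refl)) ,
                (j , j<k , refl) , (i , <-trans i<j j<k , refl))
               (rec i<j (<-trans i<j j<k))

      prefix-connected : ∀ k → PrefixConnected T a k
      prefix-connected k i j i<k j<k =
        path-to-root i i<k ++ᵖ reverseᵖ EdgeIn-sym (path-to-root j j<k)

      T-connected : Connected T
      T-connected _ _ (i , refl) (j , refl) = mapᵖ proj₁
        (prefix-connected (suc (i ⊔ j)) i j (s≤s (m≤m⊔n i j)) (s≤s (m≤n⊔m i j)))

      -- A bound would give an injection of ℕ into a finite set.
      a-unbounded : ∀ n → ∃[ m ] n ≤ a m
      a-unbounded n = dne λ none →
        Fin.ℕ→Fin-notInjective (λ k → fromℕ< (≰⇒> λ n≤ak → none (k , n≤ak)))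
          (λ e → a-injective (Fin.fromℕ<-injective _ _ _ _ e))

      count-below : ∀ n → ∃[ m ] CountBelow a n m
      count-below n =
        let m , n≤am , below = least (λ m → n ≤ a m) (a-unbounded n)
        in m , (λ i i<m → ≰⇒> (below i<m)) , n≤am

      -- Since `a m` is the least frontier vertex and is at least `n`, the first `m` vertices
      -- already contain the component; fewer than half of `n` would make it small.
      half-visited : ∀ {n m} → v < n → ¬ Small (Comp col n v) n → CountBelow a n m → n ≤ 2 * m
      half-visited {n} {m} v<n ¬small (_ , n≤am) = ≮⇒≥ λ 2m<n → ¬small
        ( visited m
        , (λ _ → exhausts v<n (λ y<n → a-least m (<-≤-trans y<n n≤am)))
        , subst (λ l → 2 * l < n) (sym (length-visited m)) 2m<n )

      often-half : ∀ {q} → q <ℚ ½ → InfOftenAbove a q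
      -- The successor puts `v` below the bound obtained and makes that bound nonzero, as the
      -- denominator `suc n` demands.
      often-half q<½ N with large (suc (v ⊔ N))
      ... | suc n , s≤s vN≤n , ¬small =
        let m , below = count-below (suc n)
            v<1+n = s≤s (≤-trans (m≤m⊔n v N) vN≤n)
        in n , ≤-trans (m≤n⊔m v N) vN≤n , m , below ,
           ℚ.<-≤-trans q<½ (half≤ m (half-visited v<1+n ¬small below))

      T-density : StrongUpperDensityAtLeast T ½
      T-density ε 0<ε =
        a , (a-injective , (λ k → k , refl) , (λ _ v∈ → v∈) , (λ k _ → prefix-connected k)) ,
        often-half (½-ε<½ 0<ε)

theorem1p12 : ExcludedMiddle 0ℓ → (c : Coloring) → IsSymmetric c →
    Σ Subgraph (λ T → Σ (Fin 3) (λ col →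
    Monochromatic c col T × Connected T × StrongUpperDensityAtLeast T ½))
theorem1p12 em c c-sym =
  let col , v , large = often-large em c c-sym
      open Prim em c c-sym col v large
  in T , col , (λ (_ , e , _) → e) , T-connected , T-density
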